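{- Let $n\ge 1$, let $a=(a_1,\ldots,a_n)$ and $b=(b_1,\ldots,b_n)$ be two $n$-tuples of positive integers, and let $X$ be a non-empty finite set of positive integers such that $\gcd(X\cup\{b_1,\ldots,b_n\})=1$. Then the following procedure stops after finitely many steps and returns $M(a,b,X)$. (1) Set $A=\emptyset$ and $G=X$. (2) If $G\setminus A=\emptyset$, then return $\langle G\rangle$ and stop. (3) Set $m=\min(G\setminus A)$. (4) Set $H=\{a_im+b_i \mid i\in\{1,\ldots,n\} \text{ and } a_im+b_i\notin\langle G\rangle\}$. (5) If $H=\emptyset$, then go to (7). (6) Set $G=G\cup H$. (7) Set $A=A\cup\{m\}$ and go to (2).
   Context: $\mathbb{N}$ is the set of non-negative integers. $\langle G\rangle$ denotes the submonoid of $(\mathbb{N},+)$ generated by $G$. A numerical semigroup is a submonoid $S$ of $(\mathbb{N},+)$ with $\mathbb{N}\setminus S$ finite. For $s\in\mathbb{N}$, $as+b=(a_1s+b_1,\ldots,a_ns+b_n)$. $\mathcal{N}(a,b,X)$ is the set of all numerical semigroups $S$ such that $X\subseteq S$ and $as+b\in S^n$ for all $s\in S\setminus\{0\}$. $M(a,b,X)=\bigcap_{S\in\mathcal{N}(a,b,X)}S$. -}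

module Defs where

open import Data.Bool using (if_then_else_)
open import Data.List using (List; []; _∷_; _++_; filter; foldr; null; tabulate)
open import Data.List.Extrema.Nat using (min)
open import Data.List.Membership.Propositional using (lose; find) renaming (_∈_ to _∈ˡ_)
open import Data.List.Relation.Unary.Any using (any?)
open import Data.Nat
open import Data.Nat.GCD using (gcd)
open import Data.Nat.Induction using (<-rec)
open import Data.Nat.Properties
open import Data.Product using (∃; _×_; _,_; proj₁)
open import Data.Sum using (_⊎_; inj₁; inj₂)
open import Data.Vec.Functional using (Vector)
open import Level using (0ℓ) renaming (suc to lsuc)
open import Relation.Binary.PropositionalEquality using (_≡_; _≢_; refl; sym; subst)
open import Relation.Nullary using (Dec; yes; no; ¬?; contradiction)
open import Relation.Nullary.Decidable using (map′)
open import Relation.Unary using (Pred; _∈_; _⊆_; _≐_; ∁; ⋂; Decidable)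

open import Data.List.Membership.DecPropositional _≟_ using (_∉?_)

-- Arbitrary subsets of ℕ are predicates.  A list stands for the finite set of
-- its elements; order and repetitions carry no meaning.

elements : List ℕ → Pred ℕ 0ℓ
elements xs k = k ∈ˡ xs

Finite : Pred ℕ 0ℓ → Set
Finite P = ∃ λ xs → P ≐ elements xs

gcdˡ : List ℕ → ℕ
gcdˡ = foldr gcd 0

record IsSubmonoid (S : Pred ℕ 0ℓ) : Set where
  field
    0∈       : 0 ∈ S
    +-closed : ∀ {x y} → x ∈ S → y ∈ S → x + y ∈ S

record IsNumericalSemigroup (S : Pred ℕ 0ℓ) : Set where
  field
    isSubmonoid      : IsSubmonoid S
    finiteComplement : Finite (∁ S)

data ⟨_⟩ (G : List ℕ) : Pred ℕ 0ℓ where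
  gen  : ∀ {g} → g ∈ˡ G → g ∈ ⟨ G ⟩
  zero : 0 ∈ ⟨ G ⟩
  add  : ∀ {x y} → x ∈ ⟨ G ⟩ → y ∈ ⟨ G ⟩ → x + y ∈ ⟨ G ⟩

affine : ∀ {n} → Vector ℕ n → Vector ℕ n → ℕ → Vector ℕ n
affine a b s i = a i * s + b i

record 𝒩 {n} (a b : Vector ℕ n) (X : List ℕ) (S : Pred ℕ 0ℓ) : Set where
  field
    isNumericalSemigroup : IsNumericalSemigroup S
    contains             : elements X ⊆ S
    affine-closed        : ∀ {s} → s ∈ S → s ≢ 0 → ∀ i → affine a b s i ∈ S

M : ∀ {n} → Vector ℕ n → Vector ℕ n → List ℕ → Pred ℕ (lsuc 0ℓ)
M a b X = ⋂ (∃ (𝒩 a b X)) proj₁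

-- Membership in ⟨ G ⟩ is decided by subtracting positive generators: a nonzero
-- k lies in ⟨ G ⟩ iff k ∸ g does for some generator g with 0 < g ≤ k.

module _ (G : List ℕ) where

  Peel : ℕ → ℕ → Set
  Peel k g = 0 < g × g ≤ k × k ∸ g ∈ ⟨ G ⟩

  peel : ∀ {k} → k ∈ ⟨ G ⟩ → k ≢ 0 → ∃ λ g → g ∈ˡ G × Peel k g
  peel {k} (gen g∈G) k≢0 =
    k , g∈G , n≢0⇒n>0 k≢0 , ≤-refl , subst (_∈ ⟨ G ⟩) (sym (n∸n≡0 k)) zero
  peel zero 0≢0 = contradiction refl 0≢0
  peel (add {zero} x∈ y∈) k≢0 = peel y∈ k≢0
  peel (add {suc x} {y} x∈ y∈) _ with peel x∈ (λ ())
  ... | g , g∈G , 0<g , g≤x , r =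
    g , g∈G , 0<g , ≤-trans g≤x (m≤m+n (suc x) y) ,
    subst (_∈ ⟨ G ⟩) (sym (+-∸-comm y g≤x)) (add r y∈)

  unpeel : ∀ {k g} → g ∈ˡ G → Peel k g → k ∈ ⟨ G ⟩
  unpeel g∈G (_ , g≤k , r) = subst (_∈ ⟨ G ⟩) (m+[n∸m]≡n g≤k) (add (gen g∈G) r)

  ∈⟨_⟩? : Decidable ⟨ G ⟩
  ∈⟨_⟩? = <-rec (λ k → Dec (k ∈ ⟨ G ⟩)) decide
    where
    decide : ∀ k → (∀ {j} → j < k → Dec (j ∈ ⟨ G ⟩)) → Dec (k ∈ ⟨ G ⟩)
    decide zero      _   = yes zero
    decide k@(suc _) rec = map′
      (λ p → let (g , g∈G , q) = find p in unpeel g∈G q)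
      (λ k∈ → let (g , g∈G , q) = peel k∈ (λ ()) in lose g∈G q)
      (any? peel? G)
      where
      peel? : Decidable (Peel k)
      peel? g with 0 <? g | g ≤? k
      ... | no ¬p   | _       = no λ (p , _) → ¬p p
      ... | yes _   | no ¬p   = no λ (_ , p , _) → ¬p p
      ... | yes 0<g | yes g≤k =
        map′ (λ r → 0<g , g≤k , r) (λ (_ , _ , r) → r)
             (rec (∸-monoʳ-< 0<g g≤k))

record State : Set where
  constructor ⟪_,_⟫
  field
    A G : List ℕ

start : List ℕ → State
start X = ⟪ [] , X ⟫

newElements : ∀ {n} → Vector ℕ n → Vector ℕ n → List ℕ → ℕ → List ℕ
newElements a b G m = filter (λ k → ¬? (∈⟨ G ⟩? k)) (tabulate (affine a b m))

process : ∀ {n} → Vector ℕ n → Vector ℕ n → State → ℕ → State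
process a b ⟪ A , G ⟫ m = ⟪ m ∷ A , (if null H then G else G ++ H) ⟫
  where
  H : List ℕ
  H = newElements a b G m

-- One pass of the loop: either the updated pair, or the returned set.

step : ∀ {n} → Vector ℕ n → Vector ℕ n → State → State ⊎ Pred ℕ 0ℓ
step a b s@(⟪ A , G ⟫) with filter (_∉? A) G
... | []     = inj₂ ⟨ G ⟩
... | x ∷ xs = inj₁ (process a b s (min x xs))

-- `Returns a b s R`: run from state s, the procedure stops after finitely many
-- passes and returns the set R.

data Returns {n} (a b : Vector ℕ n) (s : State) (R : Pred ℕ 0ℓ) : Set₁ where
  stop     : step a b s ≡ inj₂ R → Returns a b s R
  continue : ∀ {s′} → step a b s ≡ inj₁ s′ → Returns a b s′ R → Returns a b s R

{-# OPTIONS --safe #-}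

-- Once the first element m has been processed, every common divisor of G
-- divides m and a i * m + b i, hence b i; as X ⊆ G, gcd G = 1, and ⟨ G ⟩ contains all
-- integers from some c on.  From then on only the elements below c can
-- contribute new generators, so the pair (number of unprocessed k < c, number
-- of unprocessed elements of G) decreases lexicographically.  When everything
-- is processed, ⟨ G ⟩ is closed under the affine maps because
-- a (x + y) + b = a x + (a y + b), and each generator was forced to lie in
-- every member of 𝒩 a b X.

module Submission where

open import Defs
open import Data.Bool using (if_then_else_)
open import Data.List using (List; []; _∷_; _++_; tabulate; filter; length; null; upTo)
open import Data.List.Extrema.Nat using (min; argmin-sel)
open import Data.List.Membership.Propositional using (_∉_) renaming (_∈_ to _∈ˡ_)
open import Data.List.Membership.Propositional.Properties
  using (∈-++⁺ˡ; ∈-++⁺ʳ; ∈-++⁻; ∈-filter⁺; ∈-filter⁻; ∈-tabulate⁺; ∈-tabulate⁻; ∈-upTo⁺)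
open import Data.List.Properties using (++-identityʳ; filter-none)
open import Data.List.Relation.Binary.Equality.Propositional using (≋⇒≡)
import Data.List.Relation.Binary.Sublist.Propositional as Sublist
import Data.List.Relation.Binary.Sublist.Propositional.Properties as Sublistₚ
open import Data.List.Relation.Unary.All as All using (All; []; _∷_)
import Data.List.Relation.Unary.All.Properties as All
open import Data.List.Relation.Unary.Any using (here; there)
open import Data.Nat
  using (ℕ; zero; suc; _+_; _*_; _∸_; _≤_; _<_; s≤s; _<?_; >-nonZero)
open import Data.Nat.DivMod using (_/_; _%_; m≡m%n+[m/n]*n; m%n<n; m*n/n≡m; /-monoˡ-≤)
open import Data.Nat.GCD using (gcd; gcd-GCD; module Bézout)
open import Data.Nat.Properties
open import Data.Nat.Tactic.RingSolver using (solve-∀)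
open import Data.Product using (∃; _×_; _,_; proj₁; proj₂)
open import Data.Sum using (inj₁; inj₂)
open import Data.Vec.Functional using (Vector)
open import Function using (_∘_)
open import Data.List.Membership.DecPropositional _≟_ using (_∈?_; _∉?_)
open import Level using (0ℓ)
open import Relation.Binary.PropositionalEquality
  using (_≡_; _≢_; refl; sym; trans; cong; subst; module ≡-Reasoning)
open import Relation.Nullary using (yes; no; ¬?; contradiction)
open import Relation.Nullary.Decidable using (decidable-stable)
open import Relation.Unary using (Pred; _∈_; _⊆_; _≐_; Decidable)

-- Submonoids of ℕ whose differences have gcd 1 are cofinite.

module Submonoid {S : Pred ℕ 0ℓ} (isSubmonoid : IsSubmonoid S) where

  open IsSubmonoid isSubmonoid

  *-closed : ∀ k {x} → x ∈ S → k * x ∈ S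
  *-closed zero    x∈ = 0∈
  *-closed (suc k) x∈ = +-closed x∈ (*-closed k x∈)

  -- The nonnegative part of the subgroup of ℤ generated by S.
  Difference : Pred ℕ 0ℓ
  Difference d = ∃ λ v → v ∈ S × v + d ∈ S

  ∈⇒Difference : S ⊆ Difference
  ∈⇒Difference x∈ = 0 , 0∈ , x∈

  Difference-combine : ∀ {d g h} → Difference g → Difference h →
                       ∀ x y → d + y * h ≡ x * g → Difference d
  Difference-combine {d} {g} {h} (p , p∈ , p+g∈) (q , q∈ , q+h∈) x y eq =
    -- The equation says `d = x g - y h`. Taking `q + h` here and `q` in the larger element realises
    -- `- y h` without subtraction.
    x * p + y * (q + h) ,
    +-closed (*-closed x p∈) (*-closed y q+h∈) ,
    subst (_∈ S) (sym shift) (+-closed (*-closed x p+g∈) (*-closed y q∈))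
    where
    open ≡-Reasoning
    expand : ∀ x y p q h d → x * p + y * (q + h) + d ≡ (d + y * h) + (x * p + y * q)
    expand = solve-∀
    collect : ∀ x y p q g → x * g + (x * p + y * q) ≡ x * (p + g) + y * q
    collect = solve-∀
    shift : x * p + y * (q + h) + d ≡ x * (p + g) + y * q
    shift = begin
      x * p + y * (q + h) + d         ≡⟨ expand x y p q h d ⟩
      (d + y * h) + (x * p + y * q)   ≡⟨ cong (_+ (x * p + y * q)) eq ⟩
      x * g + (x * p + y * q)         ≡⟨ collect x y p q g ⟩
      x * (p + g) + y * q             ∎

  Difference-gcd : ∀ {g h} → Difference g → Difference h → Difference (gcd g h)
  Difference-gcd {g} {h} Dg Dh with Bézout.identity (gcd-GCD g h)
  ... | Bézout.+- x y eq = Difference-combine Dg Dh x y eq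
  ... | Bézout.-+ x y eq = Difference-combine Dh Dg y x eq

  Difference-gcdˡ : ∀ {xs} → All Difference xs → Difference (gcdˡ xs)
  Difference-gcdˡ []         = ∈⇒Difference 0∈
  Difference-gcdˡ (Dx ∷ Dxs) = Difference-gcd Dx (Difference-gcdˡ Dxs)

  -- With v and v + 1 in S, each k ≥ v² is q v + r = (q ∸ r) v + r (v + 1), r < v ≤ q.
  cofinite : Difference 1 → ∃ λ c → ∀ {k} → c ≤ k → k ∈ S
  -- Division by `v` needs `v` nonzero; for `v = 0`, 1 itself lies in `S`.
  cofinite (zero , _ , 1∈) = 0 , λ {k} _ → subst (_∈ S) (*-identityʳ k) (*-closed k 1∈)
  cofinite (v@(suc _) , v∈ , v+1∈) = v * v , large
    where
    regroup : ∀ s r v → s * v + r * (v + 1) ≡ r + (s + r) * v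
    regroup = solve-∀
    large : ∀ {k} → v * v ≤ k → k ∈ S
    large {k} v²≤k =
      subst (_∈ S) decompose (+-closed (*-closed (q ∸ r) v∈) (*-closed r v+1∈))
      where
      q = k / v
      r = k % v
      r≤q : r ≤ q
      r≤q = ≤-trans (<⇒≤ (m%n<n k v)) (subst (_≤ q) (m*n/n≡m v v) (/-monoˡ-≤ v v²≤k))
      open ≡-Reasoning
      decompose : (q ∸ r) * v + r * (v + 1) ≡ k
      decompose = begin
        (q ∸ r) * v + r * (v + 1)   ≡⟨ regroup (q ∸ r) r v ⟩
        r + (q ∸ r + r) * v         ≡⟨ cong (λ t → r + t * v) (m∸n+n≡m r≤q) ⟩
        r + q * v                   ≡⟨ m≡m%n+[m/n]*n k v ⟨
        k                           ∎

  -- Every gap lies below `c`, so decidability of `S` lets the gaps be listed by filtering a finite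
  -- range.
  cofinite⇒numerical : Decidable S → ∀ {c} → (∀ {k} → c ≤ k → k ∈ S) →
                       IsNumericalSemigroup S
  cofinite⇒numerical ∈S? {c} large = record
    { isSubmonoid      = isSubmonoid
    ; finiteComplement = filter (¬? ∘ ∈S?) (upTo c)
      , (λ k∉ → ∈-filter⁺ (¬? ∘ ∈S?) (∈-upTo⁺ (≰⇒> (k∉ ∘ large))) k∉)
      , (λ k∈ → proj₂ (∈-filter⁻ (¬? ∘ ∈S?) {xs = upTo c} k∈))
    }

⟨⟩-isSubmonoid : ∀ G → IsSubmonoid ⟨ G ⟩
⟨⟩-isSubmonoid G = record { 0∈ = zero ; +-closed = add }

⟨⟩-least : ∀ {G S} → IsSubmonoid S → elements G ⊆ S → ⟨ G ⟩ ⊆ S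
⟨⟩-least S G⊆S (gen g∈)   = G⊆S g∈
⟨⟩-least S G⊆S zero       = IsSubmonoid.0∈ S
⟨⟩-least S G⊆S (add p q)  = IsSubmonoid.+-closed S (⟨⟩-least S G⊆S p) (⟨⟩-least S G⊆S q)

⟨⟩-++ˡ : ∀ {G} H → ⟨ G ⟩ ⊆ ⟨ G ++ H ⟩
⟨⟩-++ˡ {G} H = ⟨⟩-least (⟨⟩-isSubmonoid (G ++ H)) (gen ∘ ∈-++⁺ˡ)

-- Counting unprocessed elements.

unprocessed : List ℕ → List ℕ → List ℕ
unprocessed A = filter (_∉? A)

unprocessed-∷-⊆ : ∀ m A xs → unprocessed (m ∷ A) xs Sublist.⊆ unprocessed A xs
unprocessed-∷-⊆ m A xs =
  Sublistₚ.filter⁺ (_∉? (m ∷ A)) (_∉? A) (λ { refl k∉ → k∉ ∘ there }) (Sublist.⊆-refl {x = xs})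

unprocessed-∷-≤ : ∀ m A xs → length (unprocessed (m ∷ A) xs) ≤ length (unprocessed A xs)
unprocessed-∷-≤ m A xs = Sublistₚ.length-mono-≤ (unprocessed-∷-⊆ m A xs)

-- A sublist of equal length would be the whole list, but `m` survives only the filter by `A`.
unprocessed-∷-< : ∀ {m A xs} → m ∈ˡ xs → m ∉ A →
                  length (unprocessed (m ∷ A) xs) < length (unprocessed A xs)
unprocessed-∷-< {m} {A} {xs} m∈ m∉ = ≤∧≢⇒< (unprocessed-∷-≤ m A xs) λ eq →
  let same = ≋⇒≡ (Sublistₚ.to-≋ eq (unprocessed-∷-⊆ m A xs))
      m∈′  = subst (m ∈ˡ_) (sym same) (∈-filter⁺ (_∉? A) m∈ m∉)
  in proj₂ (∈-filter⁻ (_∉? (m ∷ A)) {xs = xs} m∈′) (here refl)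

-- Lets every pass be treated as an append, whether or not new elements arise.
if-null-++ : ∀ (G H : List ℕ) → (if null H then G else G ++ H) ≡ G ++ H
if-null-++ G []      = sym (++-identityʳ G)
if-null-++ G (_ ∷ _) = refl

min-∈ : ∀ x xs → min x xs ∈ˡ x ∷ xs
min-∈ x xs with argmin-sel (λ k → k) x xs
... | inj₁ eq = here eq
... | inj₂ ∈xs = there ∈xs

-- One pass of the loop, and closure under the affine maps.

module _ {n} (a b : Vector ℕ n) where

  data StepView (A G : List ℕ) : Set₁ where
    stops     : step a b ⟪ A , G ⟫ ≡ inj₂ ⟨ G ⟩ → (∀ {g} → g ∈ˡ G → g ∈ˡ A) → StepView A G
    processes : ∀ {m} → m ∈ˡ G → m ∉ A →
                step a b ⟪ A , G ⟫ ≡ inj₁ ⟪ m ∷ A , G ++ newElements a b G m ⟫ →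
                StepView A G

  -- `step` branches on the filtered list; receiving its value as an equation lets `rewrite` resolve
  -- that branch.
  step-[] : ∀ A G → unprocessed A G ≡ [] → step a b ⟪ A , G ⟫ ≡ inj₂ ⟨ G ⟩
  step-[] A G eq rewrite eq = refl

  step-∷ : ∀ A G {x xs} → unprocessed A G ≡ x ∷ xs →
           step a b ⟪ A , G ⟫ ≡ inj₁ (process a b ⟪ A , G ⟫ (min x xs))
  step-∷ A G eq rewrite eq = refl

  stepView : ∀ A G → StepView A G
  stepView A G with unprocessed A G in eq
  ... | [] = stops (step-[] A G eq) λ {g} g∈ → decidable-stable (g ∈? A) λ g∉ →
    contradiction (subst (g ∈ˡ_) eq (∈-filter⁺ (_∉? A) g∈ g∉)) λ ()
  ... | x ∷ xs = processes m∈G m∉A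
    (trans (step-∷ A G eq) (cong (λ G′ → inj₁ ⟪ m ∷ A , G′ ⟫) (if-null-++ G (newElements a b G m))))
    where
    m = min x xs
    m∈ : m ∈ˡ G × m ∉ A
    m∈ = ∈-filter⁻ (_∉? A) {xs = G} (subst (m ∈ˡ_) (sym eq) (min-∈ x xs))
    m∈G = proj₁ m∈
    m∉A = proj₂ m∈

  newElements-⁻ : ∀ {G m k} → k ∈ˡ newElements a b G m → ∃ λ i → k ≡ affine a b m i
  newElements-⁻ {G} {m} k∈ =
    ∈-tabulate⁻ (proj₁ (∈-filter⁻ (¬? ∘ ∈⟨ G ⟩?) {xs = tabulate (affine a b m)} k∈))

  newElements-[] : ∀ {G m} → (∀ i → affine a b m i ∈ ⟨ G ⟩) → newElements a b G m ≡ []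
  newElements-[] {G} images∈ =
    filter-none (¬? ∘ ∈⟨ G ⟩?) (All.tabulate⁺ λ i i∉ → i∉ (images∈ i))

  affine∈⟨++newElements⟩ : ∀ G m i → affine a b m i ∈ ⟨ G ++ newElements a b G m ⟩
  affine∈⟨++newElements⟩ G m i with ∈⟨ G ⟩? (affine a b m i)
  ... | yes k∈ = ⟨⟩-++ˡ _ k∈
  ... | no  k∉ = gen (∈-++⁺ʳ G (∈-filter⁺ (¬? ∘ ∈⟨ G ⟩?) (∈-tabulate⁺ i) k∉))

  affine-+ : ∀ x y i → affine a b (x + y) i ≡ a i * x + affine a b y i
  affine-+ x y i = distribute (a i) x y (b i)
    where
    distribute : ∀ a x y b → a * (x + y) + b ≡ a * x + (a * y + b)
    distribute = solve-∀

  affine-closed-⟨⟩ : ∀ {G} → (∀ {g} → g ∈ˡ G → ∀ i → affine a b g i ∈ ⟨ G ⟩) →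
                     ∀ {s} → s ∈ ⟨ G ⟩ → s ≢ 0 → ∀ i → affine a b s i ∈ ⟨ G ⟩
  affine-closed-⟨⟩ images∈ (gen g∈) _ i = images∈ g∈ i
  affine-closed-⟨⟩ images∈ zero 0≢0 i = contradiction refl 0≢0
  -- The summand that absorbs `b i` must be nonzero: normally the second, but the first when the
  -- second is 0.
  affine-closed-⟨⟩ images∈ (add {x} {zero} p q) x+0≢0 i =
    subst (λ s → affine a b s i ∈ ⟨ _ ⟩) (sym (+-identityʳ x))
      (affine-closed-⟨⟩ images∈ p (x+0≢0 ∘ trans (+-identityʳ x)) i)
  affine-closed-⟨⟩ {G} images∈ (add {x} {y@(suc _)} p q) _ i =
    subst (_∈ ⟨ G ⟩) (sym (affine-+ x y i))
      (add (Submonoid.*-closed (⟨⟩-isSubmonoid G) (a i) p)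
           (affine-closed-⟨⟩ images∈ q (λ ()) i))

  -- Loop invariant and correctness of the returned set.

  module Procedure (b>0 : ∀ i → 0 < b i) (X : List ℕ) where

    -- `forced` puts `⟨ G ⟩` inside `M a b X`. Once `G` is contained in `A`, `contains` and
    -- `images∈` help to make `⟨ G ⟩` a member of `𝒩 a b X`. `positive` keeps `forced` inductive,
    -- because `affine-closed` speaks only of nonzero elements.
    record Invariant (A G : List ℕ) : Set₁ where
      field
        contains : elements X ⊆ elements G
        positive : ∀ {g} → g ∈ˡ G → 0 < g
        forced   : ∀ {S} → 𝒩 a b X S → elements G ⊆ S
        images∈  : ∀ {m} → m ∈ˡ A → ∀ i → affine a b m i ∈ ⟨ G ⟩

    process-Invariant : ∀ {A G m} → m ∈ˡ G → Invariant A G →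
                        Invariant (m ∷ A) (G ++ newElements a b G m)
    process-Invariant {A} {G} {m} m∈ inv = record
      { contains = ∈-++⁺ˡ ∘ contains
      ; positive = positive′
      ; forced   = forced′
      ; images∈  = λ { (here refl) → affine∈⟨++newElements⟩ G m
                     ; (there m′∈) i → ⟨⟩-++ˡ _ (images∈ m′∈ i) }
      }
      where
      open Invariant inv
      G′ = G ++ newElements a b G m
      positive′ : ∀ {g} → g ∈ˡ G′ → 0 < g
      positive′ g∈ with ∈-++⁻ G g∈
      ... | inj₁ g∈G = positive g∈G
      ... | inj₂ g∈H with newElements-⁻ {G} g∈H
      ...   | i , refl = ≤-trans (b>0 i) (m≤n+m (b i) (a i * m))
      forced′ : ∀ {S} → 𝒩 a b X S → elements G′ ⊆ S
      forced′ {S} S∈𝒩 g∈ with ∈-++⁻ G g∈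
      ... | inj₁ g∈G = forced S∈𝒩 g∈G
      ... | inj₂ g∈H with newElements-⁻ {G} g∈H
      ...   | i , refl = 𝒩.affine-closed S∈𝒩 (forced S∈𝒩 m∈) (m<n⇒n≢0 (positive m∈)) i

    Correct : List ℕ → List ℕ → Set₁
    Correct A G = ∃ λ R → Returns a b ⟪ A , G ⟫ R × R ≐ M a b X

    step-Correct : ∀ {A A′ G G′} → step a b ⟪ A , G ⟫ ≡ inj₁ ⟪ A′ , G′ ⟫ →
                   Correct A′ G′ → Correct A G
    step-Correct eq (R , returns , R≐M) = R , continue eq returns , R≐M

    closed⇒≐M : ∀ {A G c} → Invariant A G → (∀ {k} → c ≤ k → k ∈ ⟨ G ⟩) →
                (∀ {g} → g ∈ˡ G → g ∈ˡ A) → ⟨ G ⟩ ≐ M a b X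
    closed⇒≐M {A} {G} inv large G⊆A =
      (λ k∈ (S , S∈𝒩) →
        ⟨⟩-least (IsNumericalSemigroup.isSubmonoid (𝒩.isNumericalSemigroup S∈𝒩))
                 (forced S∈𝒩) k∈) ,
      -- `⟨ G ⟩` is itself one of the semigroups being intersected.
      (λ k∈M → k∈M (⟨ G ⟩ , ⟨G⟩∈𝒩))
      where
      open Invariant inv
      ⟨G⟩∈𝒩 : 𝒩 a b X ⟨ G ⟩
      ⟨G⟩∈𝒩 = record
        { isNumericalSemigroup =
            Submonoid.cofinite⇒numerical (⟨⟩-isSubmonoid G) (∈⟨ G ⟩?) large
        ; contains      = gen ∘ contains
        ; affine-closed = affine-closed-⟨⟩ (images∈ ∘ G⊆A)
        }

    -- Termination once `⟨ G ⟩` contains everything from `c` on.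

    module _ (a>0 : ∀ i → 0 < a i) (c : ℕ) where

      -- Images of elements from `c` on stay there, hence already lie in `⟨ G ⟩`.
      affine≥ : ∀ m i → m ≤ affine a b m i
      affine≥ m i = ≤-trans (m≤n*m m (a i) {{>-nonZero (a>0 i)}}) (m≤m+n (a i * m) (b i))

      -- `p` and `q` bound the two counts of unprocessed elements, below `c` and in `G`; the
      -- recursion is structural in the lexicographic order on `(p, q)`.
      run : ∀ p q A G → Invariant A G → (∀ {k} → c ≤ k → k ∈ ⟨ G ⟩) →
            length (unprocessed A (upTo c)) ≤ p → length (unprocessed A G) ≤ q →
            Correct A G
      run p q A G inv large ≤p ≤q with stepView A G
      ... | stops eq G⊆A = ⟨ G ⟩ , stop eq , closed⇒≐M inv large G⊆A
      run p q A G inv large ≤p ≤q | processes {m} m∈ m∉ eq with m <? c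
      run p q A G inv large ≤p ≤q | processes {m} m∈ m∉ eq | yes m<c
        with p | <-≤-trans (unprocessed-∷-< (∈-upTo⁺ m<c) m∉) ≤p
      -- The strict drop excludes `p = 0`. As `G` may have grown, `q` is reset to its new exact
      -- count through `≤-refl`.
      ... | suc p′ | s≤s ≤p′ = step-Correct eq
        (run p′ _ _ _ (process-Invariant m∈ inv) (⟨⟩-++ˡ _ ∘ large) ≤p′ ≤-refl)
      run p q A G inv large ≤p ≤q | processes {m} m∈ m∉ eq | no m≮c
        with q | <-≤-trans (unprocessed-∷-< m∈ m∉) ≤q
      -- No generator is added here, so the count in `G` drops while the count below `c` does not
      -- rise.
      ... | suc q′ | s≤s ≤q′ = step-Correct eq
        (run p q′ _ _ (process-Invariant m∈ inv) (⟨⟩-++ˡ _ ∘ large)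
          (≤-trans (unprocessed-∷-≤ m A (upTo c)) ≤p)
          (subst (λ G′ → length (unprocessed (m ∷ A) G′) ≤ q′) (sym G′≡G) ≤q′))
        where
        G′≡G : G ++ newElements a b G m ≡ G
        G′≡G = trans
          (cong (G ++_) (newElements-[] λ i → large (≤-trans (≮⇒≥ m≮c) (affine≥ m i))))
          (++-identityʳ G)

    -- The starting state and the first pass.

    start-Invariant : All (0 <_) X → Invariant [] X
    start-Invariant X>0 = record
      { contains = λ k∈ → k∈
      ; positive = All.lookup X>0
      ; forced   = 𝒩.contains
      ; images∈  = λ ()
      }

    processed⇒cofinite : ∀ {A G m} → gcdˡ (X ++ tabulate b) ≡ 1 → Invariant A G →
                         m ∈ˡ A → m ∈ ⟨ G ⟩ → ∃ λ c → ∀ {k} → c ≤ k → k ∈ ⟨ G ⟩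
    processed⇒cofinite {G = G} {m} gcd≡1 inv m∈A m∈ = cofinite (subst Difference gcd≡1
      (Difference-gcdˡ (All.++⁺ (All.tabulate (∈⇒Difference ∘ gen ∘ contains))
        -- `b i` is the difference of `a i * m + b i` and `a i * m`, both in `⟨ G ⟩`.
        (All.tabulate⁺ λ i → a i * m , *-closed (a i) m∈ , images∈ m∈A i))))
      where
      open Invariant inv
      open Submonoid (⟨⟩-isSubmonoid G)

mainTheorem4 : (n : ℕ) → 1 ≤ n →
    (a b : Vector ℕ n) → (∀ i → 0 < a i) → (∀ i → 0 < b i) →
    (X : List ℕ) → X ≢ [] → All (0 <_) X →
    gcdˡ (X ++ tabulate b) ≡ 1 →
    ∃ λ R → Returns a b (start X) R × R ≐ M a b X
mainTheorem4 n 1≤n a b a>0 b>0 [] X≢[] X>0 gcd≡1 = contradiction refl X≢[]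
mainTheorem4 n 1≤n a b a>0 b>0 X@(_ ∷ _) X≢[] X>0 gcd≡1 with stepView a b [] X
... | stops _ X⊆[] = contradiction (X⊆[] (here refl)) λ ()
-- The first pass is split off because the bound `c` comes from an already processed element; later
-- passes keep this `c`.
... | processes m∈ _ eq = step-Correct eq (run a>0 c _ _ _ _ inv large ≤-refl ≤-refl)
  where
  open Procedure a b b>0 X
  inv = process-Invariant m∈ (start-Invariant X>0)
  conductor = processed⇒cofinite gcd≡1 inv (here refl) (gen (∈-++⁺ˡ m∈))
  c = proj₁ conductor
  large : ∀ {k} → c ≤ k → k ∈ ⟨ _ ⟩
  large = proj₂ conductor
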